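{- Let $d$ be a nonnegative integer and let $H_2(x)=(x+1)^{d+1}-x^{d+1}\in\mathbb{R}[x]$. If $H_2$ is written in the form $$H_2(x)=\sum_{i=1}^l \beta_i (x+y_i)^{e_i}$$ with real constants $\beta_i,y_i$ and nonnegative integers $e_i \leq d$ for every $i$, then $l > (d-1)/2$. -}

module Defs where

open import Level using (Level; _⊔_; suc)
open import Algebra.Bundles using (CommutativeRing)
open import Data.Nat as ℕ using (ℕ; zero)
open import Data.Fin as F using (Fin)
open import Data.Product using (Σ; ∃; _×_)
open import Relation.Nullary using (¬_)
open import Relation.Binary.Structures using (IsTotalOrder)

record RealField (c ℓ : Level) : Set (suc (c ⊔ ℓ)) where
  field
    commRing : CommutativeRing c ℓ
  open CommutativeRing commRing public
  field
    _≤_          : Carrier → Carrier → Set ℓ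
    isTotalOrder : IsTotalOrder _≈_ _≤_
    0≉1          : ¬ (0# ≈ 1#)
    inverse      : ∀ x → ¬ (x ≈ 0#) → Σ Carrier (λ y → x * y ≈ 1#)
    +-mono-≤     : ∀ {x y} z → x ≤ y → (x + z) ≤ (y + z)
    *-nonneg     : ∀ {x y} → 0# ≤ x → 0# ≤ y → 0# ≤ (x * y)
    complete     : (P : Carrier → Set (c ⊔ ℓ)) → ∃ P →
                   Σ Carrier (λ b → ∀ x → P x → x ≤ b) →
                   Σ Carrier (λ s → (∀ x → P x → x ≤ s) ×
                                    (∀ b → (∀ x → P x → x ≤ b) → s ≤ b))

module _ {c ℓ} (R : RealField c ℓ) where
  open RealField R

  pow : Carrier → ℕ → Carrier
  pow x zero = 1#
  pow x (ℕ.suc n) = x * pow x n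

  sumFin : ∀ l → (Fin l → Carrier) → Carrier
  sumFin zero f = 0#
  sumFin (ℕ.suc l) f = f F.zero + sumFin l (λ i → f (F.suc i))

  H₂ : ℕ → Carrier → Carrier
  H₂ d x = pow (x + 1#) (ℕ.suc d) - pow x (ℕ.suc d)

-- A vanishing sum Σ γᵢ (x - aᵢ)^eᵢ turns into a spline of degree D = d + 1 with
-- compact support when every power is truncated to x ≥ aᵢ.  Differentiating such
-- a spline gains at least one sign change, by Rolle.  A term (x - aᵢ)^e becomes a
-- jump after e differentiations, and discarding the resulting delta loses at most
-- two sign changes, once per term of degree ≤ d.  The D-th derivative is D! on
-- (-1, 0) and zero elsewhere: no sign change.  Hence 0 ≥ D - 2 l.
--
-- Signs of polynomial pieces are replaced by signs of their Bernstein coefficients,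
-- for which differentiation is taking differences, so that Rolle's theorem becomes
-- a statement about the partial sums of a finite sequence and neither limits nor
-- the completeness of the field are needed.

module Submission where

open import Defs
open import Level using (Level; _⊔_; Lift)
open import Data.Bool using (Bool; true; false; not)
open import Data.Bool.Properties using (not-involutive)
open import Data.Empty using (⊥-elim)
open import Data.List using (List; []; _∷_; _++_; _ʳ++_; length; map; replicate; tabulate)
open import Data.List.Properties using (++-identityʳ; length-tabulate)
open import Data.List.Relation.Unary.All using (All; []; _∷_)
import Data.List.Relation.Unary.All as All
import Data.List.Relation.Unary.All.Properties as All
open import Data.List.Relation.Binary.Permutation.Propositional using (_↭_; ↭-sym)
import Data.List.Relation.Binary.Permutation.Propositional as Perm
open import Data.List.Relation.Binary.Permutation.Propositional.Properties using (shift; ++↭ʳ++; ++⁺ˡ; All-resp-↭)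
import Data.Nat as ℕ
import Data.Nat.Properties as ℕ
open import Data.Nat using (ℕ; zero; suc; _!)
open import Data.Nat.Tactic.RingSolver using (solve-∀)
open import Algebra.Properties.CommutativeSemigroup ℕ.+-commutativeSemigroup using (x∙yz≈y∙xz)
open import Data.Fin using (Fin) renaming (zero to fzero; suc to fsuc)
open import Data.Product using (∃₂; _,_; proj₁; proj₂; _×_)
open import Data.Unit using (⊤)
open import Data.Sum using (_⊎_; inj₁; inj₂)
open import Relation.Binary.PropositionalEquality as ≡ using (_≡_; _≢_)
open import Relation.Nullary using (¬_; yes; no)
open import Relation.Binary.Structures using (IsTotalOrder)

-- Counting the levels at which a term jumps.

hit : ℕ → ℕ → ℕ
hit k n with k ℕ.≟ n
... | yes _ = 1
... | no  _ = 0

-- Level `0` is left out: a term of full degree jumps only there, and at that level the signs are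
-- read off directly.
totalHit : ℕ → ℕ → ℕ
totalHit k zero    = 0
totalHit k (suc n) = totalHit k n ℕ.+ hit k (suc n)

totalHit-high : ∀ k n → n ℕ.< k → totalHit k n ≡ 0
totalHit-high k zero _ = ≡.refl
totalHit-high k (suc n) n<k with k ℕ.≟ suc n
... | yes ≡.refl = ⊥-elim (ℕ.<-irrefl ≡.refl n<k)
... | no _ = ≡.trans (ℕ.+-identityʳ _) (totalHit-high k n (ℕ.<⇒≤ n<k))

totalHit≤1 : ∀ k n → totalHit k n ℕ.≤ 1
totalHit≤1 k zero = ℕ.z≤n
totalHit≤1 k (suc n) with k ℕ.≟ suc n
... | yes ≡.refl = ℕ.≤-reflexive (≡.cong (ℕ._+ 1) (totalHit-high k n ℕ.≤-refl))
... | no _ = ≡.subst (ℕ._≤ 1) (≡.sym (ℕ.+-identityʳ _)) (totalHit≤1 k n)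

totalHit-zero : ∀ n → totalHit 0 n ≡ 0
totalHit-zero zero = ≡.refl
totalHit-zero (suc n) = ≡.trans (ℕ.+-identityʳ _) (totalHit-zero n)

double-+ : ∀ a b c d → (2 ℕ.* a ℕ.+ b) ℕ.+ (2 ℕ.* c ℕ.+ d) ≡ 2 ℕ.* (a ℕ.+ c) ℕ.+ (b ℕ.+ d)
double-+ = solve-∀

module Spline {c ℓ} (R : RealField c ℓ) where
  open RealField R hiding (zero) renaming (_≤_ to infix 4 _≤_)
  open IsTotalOrder isTotalOrder using (total; antisym; ≤-respʳ-≈; ≤-respˡ-≈)
    renaming (trans to ≤-trans; reflexive to ≤-reflexive; refl to ≤-refl)
  open import Algebra.Properties.Ring ring
    using (-‿distribʳ-*; -‿distribˡ-*; -‿involutive; -‿+-comm; -0#≈0#; x∙y⁻¹≈ε⇒x≈y; +-identityʳ-unique)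
  open import Algebra.Properties.Semiring.Mult semiring using (×1-homo-*; ×-homo-+) renaming (_×_ to _·_)
  open import Algebra.Solver.Ring.NaturalCoefficients.Default commutativeSemiring using (solve; _:=_; _:+_; _:*_)
  open import Relation.Binary.Reasoning.Setoid setoid

  -- Ordered field arithmetic.

  ι : ℕ → Carrier
  ι n = n · 1#

  x-y≈0⇒x≈y : ∀ {x y} → x - y ≈ 0# → x ≈ y
  x-y≈0⇒x≈y = x∙y⁻¹≈ε⇒x≈y _ _

  subdivide : ∀ s t a → t - a ≈ (s - a) + (t - s)
  subdivide s t a = sym (begin
    (s - a) + (t - s)  ≈⟨ solve 4 (λ s a' t s' → (s :+ a') :+ (t :+ s') := (t :+ a') :+ (s :+ s')) refl s (- a) t (- s) ⟩
    (t - a) + (s - s)  ≈⟨ +-congˡ (-‿inverseʳ s) ⟩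
    (t - a) + 0#       ≈⟨ +-identityʳ _ ⟩
    t - a              ∎)

  *-cancel-nonzero : ∀ {x y} → ¬ (x ≈ 0#) → x * y ≈ 0# → y ≈ 0#
  *-cancel-nonzero {x} {y} x≉0 xy≈0 = let (x⁻¹ , xx⁻¹≈1) = inverse x x≉0 in begin
    y              ≈⟨ *-identityʳ y ⟨
    y * 1#         ≈⟨ *-congˡ xx⁻¹≈1 ⟨
    y * (x * x⁻¹)  ≈⟨ solve 3 (λ y x z → y :* (x :* z) := (x :* y) :* z) refl y x x⁻¹ ⟩
    x * y * x⁻¹    ≈⟨ *-congʳ xy≈0 ⟩
    0# * x⁻¹       ≈⟨ zeroˡ x⁻¹ ⟩
    0#             ∎

  neg-nonneg : ∀ {x} → x ≤ 0# → 0# ≤ - x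
  neg-nonneg {x} x≤0 = ≤-respˡ-≈ (-‿inverseʳ x) (≤-respʳ-≈ (+-identityˡ (- x)) (+-mono-≤ (- x) x≤0))

  sub-nonneg : ∀ {x y} → x ≤ y → 0# ≤ y - x
  sub-nonneg {x} x≤y = ≤-respˡ-≈ (-‿inverseʳ x) (+-mono-≤ (- x) x≤y)

  +-nonneg : ∀ {x y} → 0# ≤ x → 0# ≤ y → 0# ≤ x + y
  +-nonneg {x} {y} 0≤x 0≤y = ≤-trans 0≤y (≤-respˡ-≈ (+-identityˡ y) (+-mono-≤ y 0≤x))

  0≤1 : 0# ≤ 1#
  0≤1 with total 0# 1#
  ... | inj₁ 0≤1′ = 0≤1′
  ... | inj₂ 1≤0 = ≤-respʳ-≈
    (trans (sym (-‿distribʳ-* _ _)) (trans (-‿cong (*-identityʳ _)) (-‿involutive 1#)))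
    (*-nonneg (neg-nonneg 1≤0) (neg-nonneg 1≤0))

  ι-nonneg : ∀ n → 0# ≤ ι n
  ι-nonneg zero = ≤-refl
  ι-nonneg (suc n) = +-nonneg 0≤1 (ι-nonneg n)

  +-nonneg-≈0 : ∀ {x y} → 0# ≤ x → 0# ≤ y → x + y ≈ 0# → x ≈ 0#
  +-nonneg-≈0 {x} {y} 0≤x 0≤y x+y≈0 = antisym
    (≤-respʳ-≈ x+y≈0 (≤-respˡ-≈ (+-identityˡ x) (≤-respʳ-≈ (+-comm y x) (+-mono-≤ x 0≤y)))) 0≤x

  -- Characteristic zero comes from the order: nonnegative summands of a vanishing sum vanish, and
  -- one of them would be the unit.
  ι-≉0 : ∀ n .{{_ : ℕ.NonZero n}} → ¬ (ι n ≈ 0#)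
  ι-≉0 (suc n) eq = 0≉1 (sym (+-nonneg-≈0 0≤1 (ι-nonneg n) eq))

  -- Polar forms of sums of shifted powers.

  -- The summand γ (x - a)^e of an identity of degree D, stored with knot = a,
  -- omit = D - e and weight = γ · e! · (D - e)!, which differentiation does not change.
  record Term : Set c where
    constructor term
    field
      omit : ℕ
      knot weight : Carrier
  open Term

  -- The elementary symmetric polynomial of degree |u| - k in the v - a (v ∈ u): up to a
  -- factor, the polar form of (x - a)^(|u| - k) as a polynomial of degree |u|.
  blossom : ℕ → Carrier → List Carrier → Carrier
  blossom zero    a []      = 1#
  blossom (suc k) a []      = 0#
  blossom zero    a (v ∷ u) = (v - a) * blossom zero a u
  blossom (suc k) a (v ∷ u) = blossom k a u + (v - a) * blossom (suc k) a u

  -- Since `weight` carries e! (D - e)!, the value at n equal points x is n! times the derivative of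
  -- order D - n at x.
  form : List Term → List Carrier → Carrier
  form []      u = 0#
  form (r ∷ L) u = weight r * blossom (omit r) (knot r) u + form L u

  blossom-affine : ∀ k a s t u → blossom k a (t ∷ u) ≈ blossom k a (s ∷ u) + (t - s) * blossom k a u
  blossom-affine zero a s t u = trans (*-congʳ (subdivide s t a)) (distribʳ _ _ _)
  blossom-affine (suc k) a s t u = trans (+-congˡ (*-congʳ (subdivide s t a)))
    (solve 4 (λ p x y q → p :+ (x :+ y) :* q := (p :+ x :* q) :+ y :* q) refl
      (blossom k a u) (s - a) (t - s) (blossom (suc k) a u))

  -- The slope in any one point is the form with that point dropped; this is how differentiation
  -- becomes taking differences.
  form-affine : ∀ L s t u → form L (t ∷ u) ≈ form L (s ∷ u) + (t - s) * form L u
  form-affine [] s t u = sym (trans (+-identityˡ _) (zeroʳ _))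
  form-affine (term k a w ∷ L) s t u = trans
    (+-cong (*-congˡ (blossom-affine k a s t u)) (form-affine L s t u))
    (solve 6 (λ w p h q f g → w :* (p :+ h :* q) :+ (f :+ h :* g) := (w :* p :+ f) :+ h :* (w :* q :+ g)) refl
      w (blossom k a (s ∷ u)) (t - s) (blossom k a u) (form L (s ∷ u)) (form L u))

  blossom-∷ : ∀ a v {u u′} → (∀ k → blossom k a u ≈ blossom k a u′) → ∀ k → blossom k a (v ∷ u) ≈ blossom k a (v ∷ u′)
  blossom-∷ a v eq zero    = *-congˡ (eq zero)
  blossom-∷ a v eq (suc k) = +-cong (eq k) (*-congˡ (eq (suc k)))

  -- Two points unfold the recursion twice and lower the index by at most two, hence the three
  -- cases.
  blossom-swap : ∀ a v w u k → blossom k a (v ∷ w ∷ u) ≈ blossom k a (w ∷ v ∷ u)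
  blossom-swap a v w u zero =
    solve 3 (λ v w q → v :* (w :* q) := w :* (v :* q)) refl (v - a) (w - a) (blossom zero a u)
  blossom-swap a v w u (suc zero) =
    solve 4 (λ v w p q → w :* p :+ v :* (p :+ w :* q) := v :* p :+ w :* (p :+ v :* q)) refl
      (v - a) (w - a) (blossom zero a u) (blossom 1 a u)
  blossom-swap a v w u (suc (suc k)) =
    solve 5 (λ v w p q r → (p :+ w :* q) :+ v :* (q :+ w :* r) := (p :+ v :* q) :+ w :* (q :+ v :* r)) refl
      (v - a) (w - a) (blossom k a u) (blossom (suc k) a u) (blossom (suc (suc k)) a u)

  blossom-↭ : ∀ a {u u′} → u ↭ u′ → ∀ k → blossom k a u ≈ blossom k a u′
  blossom-↭ a Perm.refl k = refl
  blossom-↭ a (Perm.prep v p) k = blossom-∷ a v (blossom-↭ a p) k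
  blossom-↭ a (Perm.swap v w p) k =
    trans (blossom-swap a v w _ k) (blossom-∷ a w (blossom-∷ a v (blossom-↭ a p)) k)
  blossom-↭ a (Perm.trans p q) k = trans (blossom-↭ a p k) (blossom-↭ a q k)

  form-↭-points : ∀ L {u u′} → u ↭ u′ → form L u ≈ form L u′
  form-↭-points [] p = refl
  form-↭-points (r ∷ L) p = +-cong (*-congˡ (blossom-↭ (knot r) p (omit r))) (form-↭-points L p)

  form-↭-terms : ∀ {L L′} → L ↭ L′ → ∀ u → form L u ≈ form L′ u
  form-↭-terms Perm.refl u = refl
  form-↭-terms (Perm.prep r p) u = +-congˡ (form-↭-terms p u)
  form-↭-terms (Perm.swap r r′ p) u = trans (+-congˡ (+-congˡ (form-↭-terms p u)))
    (solve 3 (λ x y z → x :+ (y :+ z) := y :+ (x :+ z)) refl _ _ _)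
  form-↭-terms (Perm.trans p q) u = trans (form-↭-terms p u) (form-↭-terms q u)

  blossom-too-many : ∀ {k} a x n → n ℕ.< k → blossom k a (replicate n x) ≈ 0#
  blossom-too-many {suc k} a x zero n<k = refl
  blossom-too-many {suc k} a x (suc n) (ℕ.s≤s n<k) = trans
    (+-cong (blossom-too-many a x n n<k) (trans (*-congˡ (blossom-too-many a x n (ℕ.m≤n⇒m≤1+n n<k))) (zeroʳ _)))
    (+-identityʳ 0#)

  -- A product that omits fewer than all points contains a factor a - a. So a truncated power jumps
  -- only at the level equal to its `omit`.
  blossom-at-knot : ∀ k a n → k ≢ n → blossom k a (replicate n a) ≈ 0#
  blossom-at-knot zero a zero k≢n = ⊥-elim (k≢n ≡.refl)
  blossom-at-knot (suc k) a zero k≢n = refl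
  blossom-at-knot zero a (suc n) k≢n = trans (*-congʳ (-‿inverseʳ a)) (zeroˡ _)
  blossom-at-knot (suc k) a (suc n) k≢n = trans
    (+-cong (blossom-at-knot k a n (λ eq → k≢n (≡.cong suc eq))) (trans (*-congʳ (-‿inverseʳ a)) (zeroˡ _)))
    (+-identityʳ 0#)

  scale : ℕ → ℕ → Carrier
  scale e k = ι (e !) * ι (k !)

  ι-!-suc : ∀ n → ι (suc n !) ≈ ι (suc n) * ι (n !)
  ι-!-suc n = ×1-homo-* (suc n) (n !)

  -- The blossom at n equal points is the power times a binomial coefficient, here with denominators
  -- cleared; the last case is Pascal's rule.
  blossom-diagonal : ∀ e k {n} a x → n ≡ e ℕ.+ k →
    scale e k * blossom k a (replicate n x) ≈ ι (n !) * pow R (x - a) e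
  blossom-diagonal zero zero a x ≡.refl =
    trans (*-congʳ (*-congʳ (+-identityʳ 1#))) (*-congʳ (*-identityˡ _))
  blossom-diagonal (suc e) zero {suc n} a x eq = begin
    ι (suc e !) * o * (q * b)             ≈⟨ *-congʳ (*-congʳ (ι-!-suc e)) ⟩
    ι (suc e) * ι (e !) * o * (q * b)     ≈⟨ solve 5 (λ i f o q b → i :* f :* o :* (q :* b) := i :* (q :* (f :* o :* b))) refl
                                               (ι (suc e)) (ι (e !)) o q b ⟩
    ι (suc e) * (q * (scale e 0 * b))     ≈⟨ *-congˡ (*-congˡ (blossom-diagonal e zero a x (ℕ.suc-injective eq))) ⟩
    ι (suc e) * (q * (ι (n !) * pow R q e))  ≡⟨ ≡.cong (λ m → ι m * (q * (ι (n !) * pow R q e))) (≡.sym (≡.trans eq (ℕ.+-identityʳ (suc e)))) ⟩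
    ι (suc n) * (q * (ι (n !) * pow R q e))  ≈⟨ solve 4 (λ i f q p → i :* (q :* (f :* p)) := i :* f :* (q :* p)) refl
                                               (ι (suc n)) (ι (n !)) q (pow R q e) ⟩
    ι (suc n) * ι (n !) * pow R q (suc e)    ≈⟨ *-congʳ (ι-!-suc n) ⟨
    ι (suc n !) * pow R q (suc e)            ∎
    where
    q = x - a
    b = blossom zero a (replicate n x)
    o = ι (0 !)
  blossom-diagonal zero (suc k) {suc n} a x eq = begin
    ι 1 * ι (suc k !) * (b + q * b′)        ≈⟨ *-congˡ (+-congˡ (trans (*-congˡ (blossom-too-many a x n (ℕ.≤-reflexive eq))) (zeroʳ q))) ⟩
    ι 1 * ι (suc k !) * (b + 0#)            ≈⟨ *-cong (*-congˡ (ι-!-suc k)) (+-identityʳ b) ⟩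
    ι 1 * (ι (suc k) * ι (k !)) * b         ≈⟨ solve 4 (λ o i f b → o :* (i :* f) :* b := i :* (o :* f :* b)) refl (ι 1) (ι (suc k)) (ι (k !)) b ⟩
    ι (suc k) * (scale 0 k * b)             ≈⟨ *-congˡ (blossom-diagonal zero k a x (ℕ.suc-injective eq)) ⟩
    ι (suc k) * (ι (n !) * 1#)              ≡⟨ ≡.cong (λ m → ι m * (ι (n !) * 1#)) (≡.sym eq) ⟩
    ι (suc n) * (ι (n !) * 1#)              ≈⟨ *-assoc _ _ _ ⟨
    ι (suc n) * ι (n !) * 1#                ≈⟨ *-congʳ (ι-!-suc n) ⟨
    ι (suc n !) * 1#                        ∎
    where
    q = x - a
    b = blossom k a (replicate n x)
    b′ = blossom (suc k) a (replicate n x)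
  blossom-diagonal (suc e) (suc k) {suc n} a x eq = begin
    ι (suc e !) * ι (suc k !) * (b + q * b′)
      ≈⟨ solve 5 (λ f g b q c → f :* g :* (b :+ q :* c) := f :* g :* b :+ q :* (f :* g :* c)) refl (ι (suc e !)) (ι (suc k !)) b q b′ ⟩
    ι (suc e !) * ι (suc k !) * b + q * (ι (suc e !) * ι (suc k !) * b′)
      ≈⟨ +-cong (*-congʳ (*-congˡ (ι-!-suc k))) (*-congˡ (*-congʳ (*-congʳ (ι-!-suc e)))) ⟩
    ι (suc e !) * (ι (suc k) * ι (k !)) * b + q * (ι (suc e) * ι (e !) * ι (suc k !) * b′)
      ≈⟨ +-cong (solve 4 (λ f i g b → f :* (i :* g) :* b := i :* (f :* g :* b)) refl (ι (suc e !)) (ι (suc k)) (ι (k !)) b)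
                (solve 5 (λ q i f g b → q :* (i :* f :* g :* b) := q :* (i :* (f :* g :* b))) refl q (ι (suc e)) (ι (e !)) (ι (suc k !)) b′) ⟩
    ι (suc k) * (scale (suc e) k * b) + q * (ι (suc e) * (scale e (suc k) * b′))
      ≈⟨ +-cong (*-congˡ (blossom-diagonal (suc e) k a x n≡)) (*-congˡ (*-congˡ (blossom-diagonal e (suc k) a x (ℕ.suc-injective eq)))) ⟩
    ι (suc k) * (ι (n !) * (q * p)) + q * (ι (suc e) * (ι (n !) * p))
      ≈⟨ solve 5 (λ i j f q p → i :* (f :* (q :* p)) :+ q :* (j :* (f :* p)) := (j :+ i) :* f :* (q :* p)) refl (ι (suc k)) (ι (suc e)) (ι (n !)) q p ⟩
    (ι (suc e) + ι (suc k)) * ι (n !) * (q * p)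
      ≈⟨ *-congʳ (*-congʳ (×-homo-+ 1# (suc e) (suc k))) ⟨
    ι (suc e ℕ.+ suc k) * ι (n !) * (q * p)
      ≡⟨ ≡.cong (λ m → ι m * ι (n !) * (q * p)) (≡.sym eq) ⟩
    ι (suc n) * ι (n !) * (q * p)
      ≈⟨ *-congʳ (ι-!-suc n) ⟨
    ι (suc n !) * (q * p) ∎
    where
    q = x - a
    p = pow R q e
    b = blossom k a (replicate n x)
    b′ = blossom (suc k) a (replicate n x)
    n≡ : n ≡ suc e ℕ.+ k
    n≡ = ≡.trans (ℕ.suc-injective eq) (ℕ.+-suc e k)

  -- Polynomials with infinitely many roots, and formal derivatives.

  horner : List Carrier → Carrier → Carrier
  horner [] h = 0#
  horner (c ∷ p) h = c + h * horner p h

  -- Synthetic division by h - r.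
  quotient : Carrier → List Carrier → List Carrier
  quotient r [] = []
  quotient r (c ∷ []) = []
  quotient r (c ∷ p@(_ ∷ _)) = horner p r ∷ quotient r p

  horner-quotient : ∀ p r h → horner p h ≈ horner p r + (h - r) * horner (quotient r p) h
  horner-quotient [] r h = sym (trans (+-identityˡ _) (zeroʳ _))
  horner-quotient (c ∷ []) r h = begin
    c + h * 0#                    ≈⟨ +-congˡ (trans (zeroʳ h) (sym (zeroʳ r))) ⟩
    c + r * 0#                    ≈⟨ +-identityʳ _ ⟨
    c + r * 0# + 0#               ≈⟨ +-congˡ (zeroʳ _) ⟨
    c + r * 0# + (h - r) * 0#     ∎
  horner-quotient (c ∷ p@(_ ∷ _)) r h = begin
    c + h * horner p h                        ≈⟨ +-congˡ (*-congˡ (horner-quotient p r h)) ⟩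
    c + h * (v + d * q)                       ≈⟨ solve 5 (λ c h v d q → c :+ h :* (v :+ d :* q) := c :+ (h :* v :+ d :* (h :* q))) refl c h v d q ⟩
    c + (h * v + d * (h * q))                 ≈⟨ +-congˡ (+-congʳ (*-congʳ h≈r+d)) ⟩
    c + ((r + d) * v + d * (h * q))           ≈⟨ solve 6 (λ c r d v h q → c :+ ((r :+ d) :* v :+ d :* (h :* q)) := c :+ r :* v :+ d :* (v :+ h :* q)) refl c r d v h q ⟩
    c + r * v + d * (v + h * q)               ∎
    where
    v = horner p r
    d = h - r
    q = horner (quotient r p) h
    h≈r+d : h ≈ r + d
    h≈r+d = sym (trans (solve 3 (λ r h r′ → r :+ (h :+ r′) := h :+ (r :+ r′)) refl r h (- r)) (trans (+-congˡ (-‿inverseʳ r)) (+-identityʳ h)))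

  Zeros : List Carrier → Set (c ⊔ ℓ)
  Zeros = All (_≈ 0#)

  c+r0≈0 : ∀ {c r z} → c + r * z ≈ 0# → z ≈ 0# → c ≈ 0#
  c+r0≈0 {c} {r} {z} eq z≈0 = trans (sym (trans (+-congˡ (trans (*-congˡ z≈0) (zeroʳ r))) (+-identityʳ c))) eq

  -- The entries of the quotient are the intermediate values of Horner's scheme, and two successive
  -- ones determine the coefficient between them.
  quotient-zeros : ∀ r p → horner p r ≈ 0# → Zeros (quotient r p) → Zeros p
  quotient-zeros r [] eq _ = []
  quotient-zeros r (c ∷ []) eq _ = c+r0≈0 eq refl ∷ []
  quotient-zeros r (c ∷ p@(_ ∷ _)) eq (v≈0 ∷ q≈0) = c+r0≈0 eq v≈0 ∷ quotient-zeros r p v≈0 q≈0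

  length-quotient : ∀ {n} r p → length p ℕ.≤ suc n → length (quotient r p) ℕ.≤ n
  length-quotient r [] le = ℕ.z≤n
  length-quotient r (c ∷ []) le = ℕ.z≤n
  length-quotient {suc n} r (c ∷ p@(_ ∷ _)) (ℕ.s≤s le) = ℕ.s≤s (length-quotient r p le)
  length-quotient {zero} r (c ∷ (_ ∷ _)) (ℕ.s≤s ())

  -- The root `ι m` is split off; the later ones stay roots of the shorter quotient because they
  -- differ from it.
  vanishing⇒zeros : ∀ n p → length p ℕ.≤ n → ∀ m → (∀ k → horner p (ι (m ℕ.+ k)) ≈ 0#) → Zeros p
  vanishing⇒zeros zero [] le m root = []
  vanishing⇒zeros (suc n) p le m root = quotient-zeros r p root-r
    (vanishing⇒zeros n (quotient r p) (length-quotient r p le) (suc m) root′)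
    where
    r = ι m
    root-r : horner p r ≈ 0#
    root-r = ≡.subst (λ j → horner p (ι j) ≈ 0#) (ℕ.+-identityʳ m) (root 0)
    root′ : ∀ k → horner (quotient r p) (ι (suc m ℕ.+ k)) ≈ 0#
    root′ k = *-cancel-nonzero h-r≉0 (begin
      (h - r) * horner (quotient r p) h               ≈⟨ +-identityˡ _ ⟨
      0# + (h - r) * horner (quotient r p) h          ≈⟨ +-congʳ root-r ⟨
      horner p r + (h - r) * horner (quotient r p) h  ≈⟨ horner-quotient p r h ⟨
      horner p h                                      ≡⟨ ≡.cong (λ j → horner p (ι j)) (≡.sym (ℕ.+-suc m k)) ⟩
      horner p (ι (m ℕ.+ suc k))                      ≈⟨ root (suc k) ⟩
      0#                                              ∎)
      where
      h = ι (suc m ℕ.+ k)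
      h-r≉0 : ¬ (h - r ≈ 0#)
      h-r≉0 eq = ι-≉0 (suc k) (+-identityʳ-unique r (ι (suc k)) (begin
        r + ι (suc k)        ≈⟨ ×-homo-+ 1# m (suc k) ⟨
        ι (m ℕ.+ suc k)      ≡⟨ ≡.cong ι (ℕ.+-suc m k) ⟩
        h                    ≈⟨ x-y≈0⇒x≈y eq ⟩
        r                    ∎))

  _⊞_ : List Carrier → List Carrier → List Carrier
  [] ⊞ q = q
  (c ∷ p) ⊞ [] = c ∷ p
  (c ∷ p) ⊞ (d ∷ q) = (c + d) ∷ (p ⊞ q)

  horner-⊞ : ∀ p q h → horner (p ⊞ q) h ≈ horner p h + horner q h
  horner-⊞ [] q h = sym (+-identityˡ _)
  horner-⊞ (c ∷ p) [] h = sym (+-identityʳ _)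
  horner-⊞ (c ∷ p) (d ∷ q) h = trans (+-congˡ (*-congˡ (horner-⊞ p q h)))
    (solve 5 (λ c d h p q → c :+ d :+ h :* (p :+ q) := c :+ h :* p :+ (d :+ h :* q)) refl c d h (horner p h) (horner q h))

  -- Coefficients of h ↦ form L ((x + h)^m ++ u).
  taylor : List Term → Carrier → ℕ → List Carrier → List Carrier
  taylor L x zero    u = form L u ∷ []
  taylor L x (suc m) u = taylor L x m (x ∷ u) ⊞ (0# ∷ taylor L x m u)

  horner-taylor : ∀ L x h m u → horner (taylor L x m u) h ≈ form L (replicate m (x + h) ++ u)
  horner-taylor L x h zero u = trans (+-congˡ (zeroʳ h)) (+-identityʳ _)
  horner-taylor L x h (suc m) u = begin
    horner (taylor L x (suc m) u) h
      ≈⟨ horner-⊞ (taylor L x m (x ∷ u)) (0# ∷ taylor L x m u) h ⟩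
    horner (taylor L x m (x ∷ u)) h + (0# + h * horner (taylor L x m u) h)
      ≈⟨ +-cong (horner-taylor L x h m (x ∷ u)) (trans (+-identityˡ _) (*-congˡ (horner-taylor L x h m u))) ⟩
    form L (xs ++ x ∷ u) + h * form L (xs ++ u)
      ≈⟨ +-cong (form-↭-points L (shift x xs u)) (*-congʳ (sym x+h-x≈h)) ⟩
    form L (x ∷ xs ++ u) + (x + h - x) * form L (xs ++ u)
      ≈⟨ form-affine L x (x + h) (xs ++ u) ⟨
    form L (x + h ∷ xs ++ u) ∎
    where
    xs = replicate m (x + h)
    x+h-x≈h : x + h - x ≈ h
    x+h-x≈h = trans (solve 3 (λ x h y → x :+ h :+ y := h :+ (x :+ y)) refl x h (- x))
      (trans (+-congˡ (-‿inverseʳ x)) (+-identityʳ h))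

  coeff₀ coeff₁ : List Carrier → Carrier
  coeff₀ [] = 0#
  coeff₀ (c ∷ p) = c
  coeff₁ [] = 0#
  coeff₁ (c ∷ p) = coeff₀ p

  coeff₀-⊞ : ∀ p q → coeff₀ (p ⊞ q) ≈ coeff₀ p + coeff₀ q
  coeff₀-⊞ [] q = sym (+-identityˡ _)
  coeff₀-⊞ (c ∷ p) [] = sym (+-identityʳ _)
  coeff₀-⊞ (c ∷ p) (d ∷ q) = refl

  coeff₁-⊞ : ∀ p q → coeff₁ (p ⊞ q) ≈ coeff₁ p + coeff₁ q
  coeff₁-⊞ [] q = sym (+-identityˡ _)
  coeff₁-⊞ (c ∷ p) [] = sym (+-identityʳ _)
  coeff₁-⊞ (c ∷ p) (d ∷ q) = coeff₀-⊞ p q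

  coeff₁-zeros : ∀ {p} → Zeros p → coeff₁ p ≈ 0#
  coeff₁-zeros [] = refl
  coeff₁-zeros (_ ∷ []) = refl
  coeff₁-zeros (_ ∷ eq ∷ _) = eq

  coeff₀-taylor : ∀ L x m u → coeff₀ (taylor L x m u) ≈ form L (replicate m x ++ u)
  coeff₀-taylor L x zero u = refl
  coeff₀-taylor L x (suc m) u = trans (coeff₀-⊞ (taylor L x m (x ∷ u)) _)
    (trans (+-identityʳ _) (trans (coeff₀-taylor L x m (x ∷ u)) (form-↭-points L (shift x (replicate m x) u))))

  -- Each of the `suc m` moving points contributes the same slope, the form with that point dropped.
  coeff₁-taylor : ∀ L x m u → coeff₁ (taylor L x (suc m) u) ≈ ι (suc m) * form L (replicate m x ++ u)
  coeff₁-taylor L x zero u = sym (trans (*-congʳ (+-identityʳ 1#)) (*-identityˡ _))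
  coeff₁-taylor L x (suc m) u = begin
    coeff₁ (taylor L x (suc (suc m)) u)
      ≈⟨ coeff₁-⊞ (taylor L x (suc m) (x ∷ u)) _ ⟩
    coeff₁ (taylor L x (suc m) (x ∷ u)) + coeff₀ (taylor L x (suc m) u)
      ≈⟨ +-cong (coeff₁-taylor L x m (x ∷ u)) (coeff₀-taylor L x (suc m) u) ⟩
    ι (suc m) * form L (xs ++ x ∷ u) + f
      ≈⟨ +-congʳ (*-congˡ (form-↭-points L (shift x xs u))) ⟩
    ι (suc m) * f + f
      ≈⟨ trans (+-comm _ _) (+-congʳ (sym (*-identityˡ f))) ⟩
    1# * f + ι (suc m) * f
      ≈⟨ distribʳ _ _ _ ⟨
    ι (suc (suc m)) * f ∎
    where
    xs = replicate m x
    f = form L (x ∷ xs ++ u)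

  -- The Taylor polynomial at x vanishes at all natural numbers, so its linear coefficient, a
  -- positive multiple of the derivative, is zero.
  form-diagonal-derivative : ∀ L m → (∀ x → form L (replicate (suc m) x) ≈ 0#) → ∀ x → form L (replicate m x) ≈ 0#
  form-diagonal-derivative L m vanish x = *-cancel-nonzero (ι-≉0 (suc m)) (begin
    ι (suc m) * form L (replicate m x)        ≡⟨ ≡.cong (λ u → ι (suc m) * form L u) (≡.sym (++-identityʳ _)) ⟩
    ι (suc m) * form L (replicate m x ++ [])  ≈⟨ coeff₁-taylor L x m [] ⟨
    coeff₁ (taylor L x (suc m) [])            ≈⟨ coeff₁-zeros (vanishing⇒zeros _ (taylor L x (suc m) []) ℕ.≤-refl 0 root) ⟩
    0#                                        ∎)
    where
    root : ∀ k → horner (taylor L x (suc m) []) (ι k) ≈ 0#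
    root k = trans (horner-taylor L x (ι k) (suc m) [])
      (trans (reflexive (≡.cong (form L) (++-identityʳ _))) (vanish (x + ι k)))

  form-diagonal-below : ∀ L {m n} → m ℕ.≤′ n → (∀ x → form L (replicate n x) ≈ 0#) → ∀ x → form L (replicate m x) ≈ 0#
  form-diagonal-below L ℕ.≤′-refl vanish = vanish
  form-diagonal-below L (ℕ.≤′-step m≤n) vanish = form-diagonal-below L m≤n (form-diagonal-derivative L _ vanish)

  -- Sign changes and a discrete Rolle theorem.

  signed : Bool → Carrier → Carrier
  signed true  x = x
  signed false x = - x

  -- The entries can be given weak signs, starting with σ, that change at most m times.
  data Alternates : Bool → ℕ → List Carrier → Set (c ⊔ ℓ) where
    []   : ∀ {σ m} → Alternates σ m []
    keep : ∀ {σ m x xs} → 0# ≤ signed σ x → Alternates σ m xs → Alternates σ m (x ∷ xs)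
    flip : ∀ {σ m xs} → Alternates (not σ) m xs → Alternates σ (suc m) xs

  weaken : ∀ {σ m xs} → Alternates σ m xs → Alternates σ (suc m) xs
  weaken []         = []
  weaken (keep p v) = keep p (weaken v)
  weaken (flip v)   = flip (weaken v)

  recount : ∀ {σ m m′ xs} → m ≡ m′ → Alternates σ m xs → Alternates σ m′ xs
  recount ≡.refl v = v

  resign : ∀ {σ σ′ m xs} → σ ≡ σ′ → Alternates σ m xs → Alternates σ′ m xs
  resign ≡.refl v = v

  signed-cong : ∀ σ {x y} → x ≈ y → signed σ x ≈ signed σ y
  signed-cong true  = λ eq → eq
  signed-cong false = -‿cong

  signed-+ : ∀ σ x y → signed σ x + signed σ y ≈ signed σ (x + y)
  signed-+ true  x y = refl
  signed-+ false x y = -‿+-comm x y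

  signed-* : ∀ σ h x → h * signed σ x ≈ signed σ (h * x)
  signed-* true  h x = refl
  signed-* false h x = sym (-‿distribʳ-* h x)

  signed-0 : ∀ σ → signed σ 0# ≈ 0#
  signed-0 true  = refl
  signed-0 false = -0#≈0#

  signed-≈0 : ∀ σ {x} → signed σ x ≈ 0# → x ≈ 0#
  signed-≈0 true  eq = eq
  signed-≈0 false eq = trans (sym (-‿involutive _)) (trans (-‿cong eq) -0#≈0#)

  nonneg-≈0 : ∀ σ {x} → x ≈ 0# → 0# ≤ signed σ x
  nonneg-≈0 σ eq = ≤-reflexive (sym (trans (signed-cong σ eq) (signed-0 σ)))

  nonneg-cong : ∀ σ {x y} → x ≈ y → 0# ≤ signed σ x → 0# ≤ signed σ y
  nonneg-cong σ eq = ≤-respʳ-≈ (signed-cong σ eq)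

  nonneg-sum : ∀ σ {x y z} → x + y ≈ z → 0# ≤ signed σ x → 0# ≤ signed σ y → 0# ≤ signed σ z
  nonneg-sum σ eq p q = nonneg-cong σ eq (≤-respʳ-≈ (signed-+ σ _ _) (+-nonneg p q))

  nonneg-total : ∀ σ x → 0# ≤ signed σ x ⊎ 0# ≤ signed (not σ) x
  nonneg-total σ x with total 0# x
  nonneg-total true  x | inj₁ p = inj₁ p
  nonneg-total true  x | inj₂ p = inj₂ (neg-nonneg p)
  nonneg-total false x | inj₁ p = inj₂ p
  nonneg-total false x | inj₂ p = inj₁ (neg-nonneg p)

  -- The starting value is not listed among the sums. That the last one vanishes expresses compact
  -- support.
  data PartialSums : Carrier → List Carrier → List Carrier → Set (c ⊔ ℓ) where
    done : ∀ {s} → s ≈ 0# → PartialSums s [] []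
    step : ∀ {s s′ x xs ys} → s + x ≈ s′ → PartialSums s′ xs ys → PartialSums s (x ∷ xs) (s′ ∷ ys)

  -- Steps of the sign of the starting value only lead away from zero, yet the sums must end there.
  monotone⇒zeros : ∀ {σ s xs ys} → Alternates σ 0 xs → PartialSums s xs ys → 0# ≤ signed σ s →
                   s ≈ 0# × Zeros xs × Zeros ys
  monotone⇒zeros [] (done s≈0) _ = s≈0 , [] , []
  monotone⇒zeros {σ} {s} (keep {x = x} p v) (step eq ps) q with monotone⇒zeros v ps (nonneg-sum σ eq q p)
  ... | s′≈0 , zx , zy = s≈0 , trans (sym (trans (+-congʳ s≈0) (+-identityˡ x))) (trans eq s′≈0) ∷ zx , s′≈0 ∷ zy
    where
    s≈0 : s ≈ 0#
    s≈0 = signed-≈0 σ (+-nonneg-≈0 q p (trans (signed-+ σ s x) (trans (signed-cong σ (trans eq s′≈0)) (signed-0 σ))))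

  zeros⇒Alternates : ∀ {σ m ys} → Zeros ys → Alternates σ m ys
  zeros⇒Alternates [] = []
  zeros⇒Alternates {σ} (eq ∷ z) = keep (nonneg-≈0 σ eq) (zeros⇒Alternates z)

  -- Rolle: the closed sequence of partial sums has one sign change less than its steps.
  -- The sums move away from zero in outward and towards or through zero in inward.
  outward : ∀ {σ m s xs ys} → Alternates σ m xs → PartialSums s xs ys → 0# ≤ signed σ s → Alternates σ (ℕ.pred m) ys
  inward  : ∀ {σ m s xs ys} → Alternates σ m xs → PartialSums s xs ys → 0# ≤ signed (not σ) s → Alternates (not σ) m ys
  outward [] (done _) q = []
  outward {σ} (keep p v) (step eq ps) q = let q′ = nonneg-sum σ eq q p in keep q′ (outward v ps q′)
  outward {σ} {s = s} (flip v) ps q = resign (not-involutive σ)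
    (inward v ps (≡.subst (λ τ → 0# ≤ signed τ s) (≡.sym (not-involutive σ)) q))
  inward [] (done _) q = []
  inward {σ} (keep p v) (step {s′ = s′} eq ps) q with nonneg-total σ s′
  ... | inj₂ q′ = keep q′ (inward v ps q′)
  -- The sum has passed zero and no change of direction is left, so it can return only if everything
  -- from here on vanishes.
  inward {σ} {zero} (keep p v) (step {s′ = s′} eq ps) q | inj₁ q′ =
    let (s′≈0 , _ , zy) = monotone⇒zeros v ps q′ in zeros⇒Alternates (s′≈0 ∷ zy)
  -- Passing zero costs one sign change, the one that `outward` saves.
  inward {σ} {suc m} (keep p v) (step eq ps) q | inj₁ q′ =
    flip (resign (≡.sym (not-involutive σ)) (keep q′ (outward v ps q′)))
  inward {σ} (flip {m = zero} v) ps q =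
    let (_ , _ , zy) = monotone⇒zeros v ps q in zeros⇒Alternates zy
  inward {σ} (flip {m = suc m} v) ps q = weaken (weaken (outward v ps q))

  -- An entry of the wrong sign costs one change before it and one after it.
  insert-entry : ∀ {σ m xs} x → Alternates σ m xs → Alternates σ (2 ℕ.+ m) (x ∷ xs)
  insert-entry {σ} x v with nonneg-total σ x
  ... | inj₁ p = keep p (weaken (weaken v))
  ... | inj₂ p = flip (keep p (flip (resign (≡.sym (not-involutive σ)) v)))

  -- The sign and the count left after the prefix are not known beforehand, so the continuation must
  -- accept any.
  scale-prefix : ∀ {σ m h} k xs {ys zs} → 0# ≤ h → Alternates σ m (xs ++ ys) →
                 (∀ {σ m} → Alternates σ m ys → Alternates σ (m ℕ.+ k) zs) →
                 Alternates σ (m ℕ.+ k) (map (h *_) xs ++ zs)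
  scale-prefix k [] h≥0 v f = f v
  scale-prefix {σ} k (x ∷ xs) h≥0 (keep p v) f =
    keep (≤-respʳ-≈ (signed-* σ _ x) (*-nonneg h≥0 p)) (scale-prefix k xs h≥0 v f)
  scale-prefix k (x ∷ xs) h≥0 (flip v) f = flip (scale-prefix k (x ∷ xs) h≥0 v f)

  -- Terms sorted by knot.

  Sorted : Carrier → List Term → Set ℓ
  Sorted s []      = Lift ℓ ⊤
  Sorted s (r ∷ L) = s ≤ knot r × Sorted (knot r) L

  Sorted-lower : ∀ {s s′} L → s′ ≤ s → Sorted s L → Sorted s′ L
  Sorted-lower []      s′≤s _       = _
  Sorted-lower (r ∷ L) s′≤s (p , q) = ≤-trans s′≤s p , q

  Sorted-insert : ∀ {s} L r → Sorted s L → s ≤ knot r →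
                  ∃₂ λ A B → L ≡ A ++ B × Sorted s (A ++ r ∷ B)
  Sorted-insert [] r srt s≤r = [] , [] , ≡.refl , s≤r , _
  Sorted-insert (r′ ∷ L) r (p , srt) s≤r with total (knot r) (knot r′)
  ... | inj₁ r≤r′ = [] , r′ ∷ L , ≡.refl , s≤r , r≤r′ , srt
  ... | inj₂ r′≤r with Sorted-insert L r srt r′≤r
  ...   | A , B , eq , srt′ = r′ ∷ A , B , ≡.cong (r′ ∷_) eq , p , srt′

  Sorted-tail : ∀ {s} A r B → Sorted s (A ++ r ∷ B) → Sorted (knot r) B
  Sorted-tail [] r B (_ , srt) = srt
  Sorted-tail (_ ∷ A) r B (_ , srt) = Sorted-tail A r B srt

  Sorted-replace-tail : ∀ {s} A r {B B′} → Sorted s (A ++ r ∷ B) → Sorted (knot r) B′ → Sorted s (A ++ r ∷ B′)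
  Sorted-replace-tail [] r (p , _) srt = p , srt
  Sorted-replace-tail (_ ∷ A) r (p , q) srt = p , Sorted-replace-tail A r q srt

  sort : ∀ s L → ∃₂ λ s′ L′ → s′ ≤ s × Sorted s′ L′ × L′ ↭ L
  sort s [] = s , [] , ≤-refl , _ , Perm.refl
  sort s (r ∷ L) with sort s L
  ... | s′ , L′ , s′≤s , srt , L′↭L with total s′ (knot r)
  ...   | inj₂ r≤s′ = knot r , r ∷ L′ , ≤-trans r≤s′ s′≤s , (≤-refl , Sorted-lower L′ r≤s′ srt) , Perm.prep r L′↭L
  ...   | inj₁ s′≤r with Sorted-insert L′ r srt s′≤r
  ...     | A , B , ≡.refl , srt′ = s′ , A ++ r ∷ B , s′≤s , srt′ , Perm.trans (shift r A B) (Perm.prep r L′↭L)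

  -- Control sequences of the truncated spline.

  -- Bernstein coefficients on [s , t] of the sum of the truncated powers whose knots are
  -- in acc, at level n = i + j, i.e. after D - n differentiations.
  bernstein : List Term → Carrier → Carrier → ℕ → ℕ → List Carrier
  bernstein acc s t zero    j = form acc (replicate j t) ∷ []
  bernstein acc s t (suc i) j = form acc (replicate (suc i) s ++ replicate j t) ∷ bernstein acc s t i (suc j)

  mutual
    -- At positive level a knot contributes both its left and its right value, which differ by the
    -- jump there.
    control : ℕ → List Term → Carrier → List Term → List Carrier
    control n acc s L = form acc (replicate n s) ∷ controlTail n acc s L

    controlTail : ℕ → List Term → Carrier → List Term → List Carrier
    controlTail n acc s [] = []
    controlTail zero acc s (r ∷ L) = control zero (r ∷ acc) (knot r) L
    controlTail (suc n) acc s (r ∷ L) = bernstein acc s (knot r) n 1 ++ control (suc n) (r ∷ acc) (knot r) L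

  -- Discontinuity of the level n spline at the knot of r; zero unless omit r = n.
  jump : ℕ → Term → Carrier
  jump n r = weight r * blossom (omit r) (knot r) (replicate n (knot r))

  differences : ℕ → List Term → Carrier → List Term → List Carrier
  differences n acc s [] = []
  differences n acc s (r ∷ L) =
    map ((knot r - s) *_) (bernstein acc s (knot r) n 0) ++ jump (suc n) r ∷ differences n (r ∷ acc) (knot r) L

  restart : ∀ L {u u′ xs ys} → u ≡ u′ → PartialSums (form L u) xs ys → PartialSums (form L u′) xs ys
  restart L ≡.refl ps = ps

  -- Neighbouring coefficients differ in one point, `s` replaced by `t`, so `form-affine` gives
  -- their difference one level lower.
  PartialSums-bernstein : ∀ acc s t i j {xs ys} →
    PartialSums (form acc (replicate (suc (i ℕ.+ j)) t)) xs ys →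
    PartialSums (form acc (replicate (suc i) s ++ replicate j t))
      (map ((t - s) *_) (bernstein acc s t i j) ++ xs) (bernstein acc s t i (suc j) ++ ys)
  PartialSums-bernstein acc s t zero j ps = step (sym (form-affine acc s t (replicate j t))) ps
  PartialSums-bernstein acc s t (suc i) j ps = step
    (trans (sym (form-affine acc s t u))
      (form-↭-points acc (↭-sym (shift t (replicate (suc i) s) (replicate j t)))))
    (PartialSums-bernstein acc s t i (suc j) (restart acc (≡.cong (λ m → replicate (suc m) t) (≡.sym (ℕ.+-suc i j))) ps))
    where
    u = replicate (suc i) s ++ replicate j t

  -- Passing a knot adds the summand of its term to the form, which is the jump. To the right of all
  -- knots the full sum remains, and that is zero by `closed`.
  PartialSums-control : ∀ n acc s L → (∀ x → form (L ʳ++ acc) (replicate (suc n) x) ≈ 0#) →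
    PartialSums (form acc (replicate (suc n) s)) (differences n acc s L) (controlTail (suc n) acc s L)
  PartialSums-control n acc s [] closed = done (closed s)
  PartialSums-control n acc s (r ∷ L) closed =
    restart acc (++-identityʳ (replicate (suc n) s))
      (PartialSums-bernstein acc s (knot r) n 0
        (restart acc (≡.cong (λ m → replicate (suc m) (knot r)) (≡.sym (ℕ.+-identityʳ n)))
          (step (+-comm _ _) (PartialSums-control n (r ∷ acc) (knot r) L closed))))

  -- Twice the number of possibly nonzero jumps at level n.
  hits : ℕ → List Term → ℕ
  hits n []      = 0
  hits n (r ∷ L) = 2 ℕ.* hit (omit r) n ℕ.+ hits n L

  insert-jump : ∀ {σ m xs} n r → Alternates σ m xs → Alternates σ (2 ℕ.* hit (omit r) n ℕ.+ m) (jump n r ∷ xs)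
  insert-jump {σ} n r v with omit r ℕ.≟ n
  ... | yes _ = insert-entry _ v
  ... | no k≢n = keep (nonneg-≈0 σ (trans (*-congˡ (blossom-at-knot (omit r) (knot r) n k≢n)) (zeroʳ _))) v

  -- Regroups the sequence by intervals, so that the coefficients of one interval form the prefix to
  -- be scaled.
  bernstein-control : ∀ n acc s r L → control n acc s (r ∷ L) ≡ bernstein acc s (knot r) n 0 ++ control n (r ∷ acc) (knot r) L
  bernstein-control zero acc s r L = ≡.refl
  bernstein-control (suc n) acc s r L =
    ≡.cong (λ u → form acc u ∷ bernstein acc s (knot r) n 1 ++ control (suc n) (r ∷ acc) (knot r) L)
      (≡.sym (++-identityʳ (replicate (suc n) s)))

  -- Interval lengths are nonnegative and keep signs; only the inserted jumps cost changes.
  Alternates-differences : ∀ n acc s L {σ m} → Sorted s L → Alternates σ m (control n acc s L) →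
    Alternates σ (m ℕ.+ hits (suc n) L) (differences n acc s L)
  Alternates-differences n acc s [] _ _ = []
  Alternates-differences n acc s (r ∷ L) {σ} {m} (s≤r , srt) v =
    scale-prefix (hits (suc n) (r ∷ L)) (bernstein acc s (knot r) n 0) (sub-nonneg s≤r)
      (≡.subst (Alternates σ m) (bernstein-control n acc s r L) v)
      λ {_} {m′} w → recount (x∙yz≈y∙xz h m′ _)
        (insert-jump (suc n) r (Alternates-differences n (r ∷ acc) (knot r) L srt w))
    where
    h = 2 ℕ.* hit (omit r) (suc n)

  -- Level zero, and why the spline does not vanish.

  -- Terms of degree < D.
  Low : List Term → Set c
  Low = All (λ r → omit r ≢ 0)

  blossom-[] : ∀ {k} a → k ≢ 0 → blossom k a [] ≈ 0#
  blossom-[] {zero}  a k≢0 = ⊥-elim (k≢0 ≡.refl)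
  blossom-[] {suc k} a k≢0 = refl

  form-low : ∀ r acc → omit r ≢ 0 → form (r ∷ acc) [] ≈ form acc []
  form-low r acc k≢0 = trans (+-congʳ (trans (*-congˡ (blossom-[] (knot r) k≢0)) (zeroʳ _))) (+-identityˡ _)

  -- Terms of lower degree have no derivative of order D, so the value stays at `v` while their
  -- knots are passed.
  control₀-low : ∀ {v L} C acc s → Low C → 0# ≤ v → form acc [] ≈ v →
    (∀ acc s → form acc [] ≈ v → Alternates true 0 (controlTail 0 acc s L)) →
    Alternates true 0 (controlTail 0 acc s (C ++ L))
  control₀-low [] acc s low v≥0 eq k = k acc s eq
  control₀-low (r ∷ C) acc s (k≢0 ∷ low) v≥0 eq k =
    let eq′ = trans (form-low r acc k≢0) eq in
    keep (≤-respʳ-≈ (sym eq′) v≥0) (control₀-low C (r ∷ acc) (knot r) low v≥0 eq′ k)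

  -- Where neighbouring coefficients vanish so does their difference, and the nonzero length can be
  -- cancelled.
  bernstein-lower : ∀ acc s t i j → ¬ (t - s ≈ 0#) → Zeros (bernstein acc s t (suc i) j) → Zeros (bernstein acc s t i j)
  bernstein-lower acc s t zero j t≉s (e ∷ e′ ∷ []) =
    *-cancel-nonzero t≉s (trans (sym (trans (+-congʳ e) (+-identityˡ _)))
      (trans (sym (form-affine acc s t (replicate j t))) e′)) ∷ []
  bernstein-lower acc s t (suc i) j t≉s (e ∷ zs@(e′ ∷ _)) =
    *-cancel-nonzero t≉s (trans (sym (trans (+-congʳ e) (+-identityˡ _)))
      (trans (sym (form-affine acc s t (replicate (suc i) s ++ replicate j t)))
        (trans (form-↭-points acc (↭-sym (shift t (replicate (suc i) s) (replicate j t)))) e′)))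
    ∷ bernstein-lower acc s t i (suc j) t≉s zs

  bernstein-zeros⇒form-[] : ∀ acc s t n → ¬ (t - s ≈ 0#) → Zeros (bernstein acc s t n 0) → form acc [] ≈ 0#
  bernstein-zeros⇒form-[] acc s t zero t≉s (e ∷ []) = e
  bernstein-zeros⇒form-[] acc s t (suc n) t≉s zs = bernstein-zeros⇒form-[] acc s t n t≉s (bernstein-lower acc s t n 0 t≉s zs)

  skip-low : ∀ {n v} A {L} acc s → Low A → form acc [] ≈ v → Zeros (differences n acc s (A ++ L)) →
    ∃₂ λ acc′ s′ → form acc′ [] ≈ v × Zeros (differences n acc′ s′ L)
  skip-low [] acc s low eq zs = acc , s , eq , zs
  skip-low {n} (r ∷ A) acc s (k≢0 ∷ low) eq zs with All.++⁻ʳ (map ((knot r - s) *_) (bernstein acc s (knot r) n 0)) zs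
  ... | _ ∷ zs′ = skip-low A (r ∷ acc) (knot r) low (trans (form-low r acc k≢0) eq) zs′

  -- Where the acc-form at [] is nonzero, vanishing differences force the interval to have
  -- length zero; equality in the field need not be stable, hence ¬ ¬.
  knots-collapse : ∀ {n v} C z L acc s → Low C → ¬ (v ≈ 0#) → form acc [] ≈ v →
    Zeros (differences n acc s (C ++ z ∷ L)) → ¬ ¬ (knot z ≈ s)
  first-knots-collapse : ∀ {n v} r L acc s → ¬ (v ≈ 0#) → form acc [] ≈ v → Zeros (differences n acc s (r ∷ L)) → ¬ ¬ (knot r ≈ s)
  first-knots-collapse {n} r L acc s v≉0 eq zs r≉s = v≉0 (trans (sym eq)
    (bernstein-zeros⇒form-[] acc s (knot r) n r-s≉0
      (All.map (*-cancel-nonzero r-s≉0) (All.map⁻ (All.++⁻ˡ (map ((knot r - s) *_) (bernstein acc s (knot r) n 0)) zs)))))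
    where
    r-s≉0 : ¬ (knot r - s ≈ 0#)
    r-s≉0 e = r≉s (x-y≈0⇒x≈y e)
  knots-collapse [] z L acc s low v≉0 eq zs = first-knots-collapse z L acc s v≉0 eq zs
  knots-collapse {n} (r ∷ C) z L acc s (k≢0 ∷ low) v≉0 eq zs z≉s
    with All.++⁻ʳ (map ((knot r - s) *_) (bernstein acc s (knot r) n 0)) zs
  ... | _ ∷ zs′ = first-knots-collapse r (C ++ z ∷ L) acc s v≉0 eq zs λ r≈s →
    knots-collapse C z L (r ∷ acc) (knot r) low v≉0 (trans (form-low r acc k≢0) eq) zs′ λ z≈r → z≉s (trans z≈r r≈s)

  form-single : ∀ r → omit r ≡ 0 → ∀ acc → form (r ∷ acc) [] ≈ weight r + form acc []
  form-single (term zero a w) ≡.refl acc = +-congʳ (*-identityʳ w)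

  totalHits : ℕ → List Term → ℕ
  totalHits zero    L = 0
  totalHits (suc n) L = totalHits n L ℕ.+ hits (suc n) L

  -- Induction over the levels.

  module TwoLeadingTerms
    (A B C : List Term) (p q : Term) (s₀ : Carrier) (D : ℕ)
    (lowA : Low A) (lowB : Low B) (lowC : Low C) (omit-p : omit p ≡ 0) (omit-q : omit q ≡ 0)
    (weight-p≥0 : 0# ≤ weight p) (weight-p≉0 : ¬ (weight p ≈ 0#)) (weight-p+q : weight q + weight p ≈ 0#) (q≉p : ¬ (knot q ≈ knot p))
    (sorted : Sorted s₀ (A ++ p ∷ B ++ q ∷ C))
    (vanish : ∀ x → form (A ++ p ∷ B ++ q ∷ C) (replicate D x) ≈ 0#)
    where
    L = A ++ p ∷ B ++ q ∷ C

    form-p : ∀ acc → form acc [] ≈ 0# → form (p ∷ acc) [] ≈ weight p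
    form-p acc eq = trans (form-single p omit-p acc) (trans (+-congˡ eq) (+-identityʳ _))

    form-q : ∀ acc → form acc [] ≈ weight p → form (q ∷ acc) [] ≈ 0#
    form-q acc eq = trans (form-single q omit-q acc) (trans (+-congˡ eq) weight-p+q)

    -- The values are zero up to `p`, `weight p` up to `q`, and zero from there on.
    Alternates-control₀ : Alternates true 0 (control 0 [] s₀ L)
    Alternates-control₀ = keep ≤-refl
      (control₀-low A [] s₀ lowA ≤-refl refl λ acc s eq →
        keep (≤-respʳ-≈ (sym (form-p acc eq)) weight-p≥0)
        (control₀-low B (p ∷ acc) (knot p) lowB weight-p≥0 (form-p acc eq) λ acc′ s′ eq′ →
          keep (≤-reflexive (sym (form-q acc′ eq′)))
          (≡.subst (λ C′ → Alternates true 0 (controlTail 0 (q ∷ acc′) (knot q) C′)) (++-identityʳ C)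
            (control₀-low C (q ∷ acc′) (knot q) lowC ≤-refl (form-q acc′ eq′) λ _ _ _ → []))))

    -- Between the distinct knots of `p` and `q` the value at level zero is `weight p`, so vanishing
    -- differences would make these knots collapse.
    differences-nonzero : ∀ n → ¬ Zeros (differences n [] s₀ L)
    differences-nonzero n zs with skip-low {n} A [] s₀ lowA refl zs
    ... | acc , s , eq , zs′ with All.++⁻ʳ (map ((knot p - s) *_) (bernstein acc s (knot p) n 0)) zs′
    ...   | _ ∷ zs″ = knots-collapse B q C (p ∷ acc) (knot p) lowB weight-p≉0 (form-p acc eq) zs″ q≉p

    closed : ∀ n → n ℕ.≤ D → ∀ x → form (L ʳ++ []) (replicate n x) ≈ 0#
    closed n n≤D x = trans (form-↭-terms (↭-sym (++↭ʳ++ L [])) _)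
      (trans (reflexive (≡.cong (λ M → form M (replicate n x)) (++-identityʳ L)))
        (form-diagonal-below L (ℕ.≤⇒≤′ n≤D) vanish x))

    -- The equation is an invariant: each level adds its hits to the count and Rolle takes one away.
    control-bound : ∀ n → n ℕ.≤ D → ∃₂ λ σ m → Alternates σ m (control n [] s₀ L) × m ℕ.+ n ≡ totalHits n L
    control-bound zero _ = true , 0 , Alternates-control₀ , ≡.refl
    control-bound (suc n) n<D with control-bound n (ℕ.<⇒≤ n<D)
    ... | σ , m , v , eq with m ℕ.+ hits (suc n) L in eq′ | Alternates-differences n [] s₀ L sorted v
    -- Without a sign change the steps of a closed sequence starting at zero all vanish.
    ...   | zero | w = ⊥-elim (differences-nonzero n
              (proj₁ (proj₂ (monotone⇒zeros w (PartialSums-control n [] s₀ L (closed (suc n) n<D)) (nonneg-≈0 σ refl)))))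
    ...   | suc m′ | w = σ , m′
              -- The leading zero is the value left of all knots, which the partial sums do not
              -- list.
              , keep (nonneg-≈0 σ refl) (outward w (PartialSums-control n [] s₀ L (closed (suc n) n<D)) (nonneg-≈0 σ refl))
              , count eq′
      where
      count : m ℕ.+ hits (suc n) L ≡ suc m′ → m′ ℕ.+ suc n ≡ totalHits (suc n) L
      count e = ≡.trans (ℕ.+-suc m′ n) (≡.trans (≡.cong (ℕ._+ n) (≡.sym e))
        (≡.trans (ℕ.+-assoc m _ n) (≡.trans (≡.cong (m ℕ.+_) (ℕ.+-comm _ n))
          (≡.trans (≡.sym (ℕ.+-assoc m n _)) (≡.cong (ℕ._+ hits (suc n) L) eq)))))

    degree≤totalHits : D ℕ.≤ totalHits D L
    degree≤totalHits with control-bound D ℕ.≤-refl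
    ... | _ , m , _ , eq = ≡.subst (D ℕ.≤_) eq (ℕ.m≤n+m D m)

  -- Bounding the total number of jumps.

  totalHits-∷ : ∀ n r L → totalHits n (r ∷ L) ≡ 2 ℕ.* totalHit (omit r) n ℕ.+ totalHits n L
  totalHits-∷ zero r L = ≡.refl
  totalHits-∷ (suc n) r L = ≡.trans (≡.cong (ℕ._+ hits (suc n) (r ∷ L)) (totalHits-∷ n r L))
    (double-+ (totalHit (omit r) n) (totalHits n L) (hit (omit r) (suc n)) (hits (suc n) L))

  totalHits-[] : ∀ n → totalHits n [] ≡ 0
  totalHits-[] zero = ≡.refl
  totalHits-[] (suc n) = ≡.trans (ℕ.+-identityʳ _) (totalHits-[] n)

  totalHits≤2*length : ∀ n L → totalHits n L ℕ.≤ 2 ℕ.* length L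
  totalHits≤2*length n [] = ℕ.≤-reflexive (totalHits-[] n)
  totalHits≤2*length n (r ∷ L) = ≡.subst₂ ℕ._≤_ (≡.sym (totalHits-∷ n r L)) (≡.sym (ℕ.*-suc 2 (length L)))
    (ℕ.+-mono-≤ (ℕ.*-monoʳ-≤ 2 (totalHit≤1 (omit r) n)) (totalHits≤2*length n L))

  hits-↭ : ∀ n {L L′} → L ↭ L′ → hits n L ≡ hits n L′
  hits-↭ n Perm.refl = ≡.refl
  hits-↭ n (Perm.prep r p) = ≡.cong (2 ℕ.* hit (omit r) n ℕ.+_) (hits-↭ n p)
  hits-↭ n (Perm.swap r r′ p) = ≡.trans (≡.cong (λ h → a ℕ.+ (b ℕ.+ h)) (hits-↭ n p))
    (x∙yz≈y∙xz a b _)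
    where
    a = 2 ℕ.* hit (omit r) n
    b = 2 ℕ.* hit (omit r′) n
  hits-↭ n (Perm.trans p q) = ≡.trans (hits-↭ n p) (hits-↭ n q)

  totalHits-↭ : ∀ n {L L′} → L ↭ L′ → totalHits n L ≡ totalHits n L′
  totalHits-↭ zero p = ≡.refl
  totalHits-↭ (suc n) p = ≡.cong₂ ℕ._+_ (totalHits-↭ n p) (hits-↭ (suc n) p)

  totalHits-omit-zero : ∀ n r L → omit r ≡ 0 → totalHits n (r ∷ L) ≡ totalHits n L
  totalHits-omit-zero n (term zero a w) L ≡.refl = ≡.trans (totalHits-∷ n _ L)
    (≡.cong (λ h → 2 ℕ.* h ℕ.+ totalHits n L) (totalHit-zero n))

  -- The tail is sorted first; `p` and then `q` behind it are inserted, so their order and the low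
  -- terms around them stay visible.
  degree≤2*length : ∀ D p q T → Low T → omit p ≡ 0 → omit q ≡ 0 → 0# ≤ weight p → ¬ (weight p ≈ 0#) →
    weight q + weight p ≈ 0# → knot p ≤ knot q → ¬ (knot q ≈ knot p) →
    (∀ x → form (p ∷ q ∷ T) (replicate D x) ≈ 0#) → D ℕ.≤ 2 ℕ.* length T
  degree≤2*length D p q T low omit-p omit-q wp≥0 wp≉0 wp+wq p≤q q≉p vanish
    with sort (knot p) T
  ... | s , T′ , s≤p , srt , T′↭T with Sorted-insert T′ p srt s≤p
  ...   | A , B′ , ≡.refl , srt′ with Sorted-insert B′ q (Sorted-tail A p B′ srt′) p≤q
  ...     | B , C , ≡.refl , srt″ = ℕ.≤-trans bound (ℕ.≤-trans
    (ℕ.≤-reflexive (≡.trans (totalHits-↭ D L↭)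
      (≡.trans (totalHits-omit-zero D p (q ∷ T) omit-p) (totalHits-omit-zero D q T omit-q))))
    (totalHits≤2*length D T))
    where
    L = A ++ p ∷ B ++ q ∷ C
    low′ : Low A × Low (B ++ C)
    low′ = All.++⁻ A (All-resp-↭ (↭-sym T′↭T) low)
    L↭ : L ↭ p ∷ q ∷ T
    L↭ = Perm.trans (shift p A (B ++ q ∷ C)) (Perm.prep p
      (Perm.trans (++⁺ˡ A (shift q B C)) (Perm.trans (shift q A (B ++ C)) (Perm.prep q T′↭T))))
    bound : D ℕ.≤ totalHits D L
    bound = TwoLeadingTerms.degree≤totalHits A B C p q s D (proj₁ low′) (All.++⁻ˡ B (proj₂ low′)) (All.++⁻ʳ B (proj₂ low′))
      omit-p omit-q wp≥0 wp≉0 wp+wq q≉p (Sorted-replace-tail A p srt′ srt″)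
      λ x → trans (form-↭-terms L↭ _) (vanish x)

  -- Application to `H₂`.

  shiftedPower : ℕ → Carrier → Carrier → ℕ → Term
  shiftedPower D γ a e = term (D ℕ.∸ e) a (γ * scale e (D ℕ.∸ e))

  shiftedPower-diagonal : ∀ D γ a e x → e ℕ.≤ D →
    weight (shiftedPower D γ a e) * blossom (D ℕ.∸ e) a (replicate D x) ≈ ι (D !) * (γ * pow R (x - a) e)
  shiftedPower-diagonal D γ a e x e≤D = begin
    γ * scale e (D ℕ.∸ e) * b    ≈⟨ *-assoc _ _ _ ⟩
    γ * (scale e (D ℕ.∸ e) * b)  ≈⟨ *-congˡ (blossom-diagonal e (D ℕ.∸ e) a x (≡.sym (ℕ.m+[n∸m]≡n e≤D))) ⟩
    γ * (ι (D !) * y)            ≈⟨ solve 3 (λ γ f y → γ :* (f :* y) := f :* (γ :* y)) refl γ (ι (D !)) y ⟩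
    ι (D !) * (γ * y)            ∎
    where
    b = blossom (D ℕ.∸ e) a (replicate D x)
    y = pow R (x - a) e

  pow-cong : ∀ {x y} n → x ≈ y → pow R x n ≈ pow R y n
  pow-cong zero eq = refl
  pow-cong (suc n) eq = *-cong eq (pow-cong n eq)

  x--y≈x+y : ∀ x y → x - - y ≈ x + y
  x--y≈x+y x y = +-congˡ (-‿involutive y)

  module Representation (d l : ℕ) (β y : Fin l → Carrier) (e : Fin l → ℕ) (e≤d : ∀ i → e i ℕ.≤ d)
    (rep : ∀ x → H₂ R d x ≈ sumFin R l (λ i → β i * pow R (x + y i) (e i))) where

    D = suc d

    -- The two powers in `H₂`, of degree D with knots -1 and 0. The given representation joins them
    -- with its signs reversed.
    p q : Term
    p = shiftedPower D 1# (- 1#) D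
    q = shiftedPower D (- 1#) 0# D

    tailTerm : Fin l → Term
    tailTerm i = shiftedPower D (- β i) (- y i) (e i)

    form-tabulate : ∀ x m (j : Fin m → Fin l) → form (tabulate (λ i → tailTerm (j i))) (replicate D x) ≈
      ι (D !) * - sumFin R m (λ i → β (j i) * pow R (x + y (j i)) (e (j i)))
    form-tabulate x zero j = sym (trans (*-congˡ -0#≈0#) (zeroʳ _))
    form-tabulate x (suc m) j = begin
      form (tabulate (λ i → tailTerm (j i))) (replicate D x)
        ≈⟨ +-cong (shiftedPower-diagonal D _ _ _ x (ℕ.m≤n⇒m≤1+n (e≤d i))) (form-tabulate x m (λ i′ → j (fsuc i′))) ⟩
      ι (D !) * (- β i * pow R (x - - y i) (e i)) + ι (D !) * - S
        ≈⟨ distribˡ _ _ _ ⟨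
      ι (D !) * (- β i * pow R (x - - y i) (e i) + - S)
        ≈⟨ *-congˡ (+-congʳ (trans (*-congˡ (pow-cong (e i) (x--y≈x+y x (y i)))) (sym (-‿distribˡ-* _ _)))) ⟩
      ι (D !) * (- (β i * pow R (x + y i) (e i)) + - S)
        ≈⟨ *-congˡ (-‿+-comm _ _) ⟩
      ι (D !) * - (β i * pow R (x + y i) (e i) + S) ∎
      where
      i = j fzero
      S = sumFin R m (λ i′ → β (j (fsuc i′)) * pow R (x + y (j (fsuc i′))) (e (j (fsuc i′))))

    vanish : ∀ x → form (p ∷ q ∷ tabulate tailTerm) (replicate D x) ≈ 0#
    vanish x = begin
      form (p ∷ q ∷ tabulate tailTerm) (replicate D x)
        ≈⟨ +-cong (shiftedPower-diagonal D _ _ D x ℕ.≤-refl)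
             (+-cong (shiftedPower-diagonal D _ _ D x ℕ.≤-refl) (form-tabulate x l (λ i → i))) ⟩
      f * (1# * pow R (x - - 1#) D) + (f * (- 1# * pow R (x - 0#) D) + f * - S)
        ≈⟨ +-cong (*-congˡ (trans (*-identityˡ _) (pow-cong D (x--y≈x+y x 1#))))
             (+-congʳ (*-congˡ (trans (*-congˡ (pow-cong D (trans (+-congˡ -0#≈0#) (+-identityʳ x))))
               (trans (sym (-‿distribˡ-* _ _)) (-‿cong (*-identityˡ _)))))) ⟩
      f * pow R (x + 1#) D + (f * - pow R x D + f * - S)
        ≈⟨ solve 4 (λ f a b s → f :* a :+ (f :* b :+ f :* s) := f :* (a :+ b :+ s)) refl f (pow R (x + 1#) D) (- pow R x D) (- S) ⟩
      f * (H₂ R d x - S)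
        ≈⟨ *-congˡ (trans (+-congʳ (rep x)) (-‿inverseʳ S)) ⟩
      f * 0#
        ≈⟨ zeroʳ f ⟩
      0# ∎
      where
      f = ι (D !)
      S = sumFin R l (λ i → β i * pow R (x + y i) (e i))

    scale-nonneg : ∀ m k → 0# ≤ scale m k
    scale-nonneg m k = *-nonneg (ι-nonneg (m !)) (ι-nonneg (k !))

    scale≉0 : ∀ m k → ¬ (scale m k ≈ 0#)
    scale≉0 m k eq = ι-≉0 (k !) {{k ℕ.!≢0}} (*-cancel-nonzero (ι-≉0 (m !) {{m ℕ.!≢0}}) eq)

    -1≤0 : - 1# ≤ 0#
    -1≤0 = ≤-respˡ-≈ (+-identityˡ _) (≤-respʳ-≈ (-‿inverseʳ 1#) (+-mono-≤ (- 1#) 0≤1))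

    degree-bound : D ℕ.≤ 2 ℕ.* l
    degree-bound = ≡.subst (λ m → D ℕ.≤ 2 ℕ.* m) (length-tabulate tailTerm)
      (degree≤2*length D p q (tabulate tailTerm)
        (All.tabulate⁺ λ i → ℕ.m>n⇒m∸n≢0 (ℕ.s≤s (e≤d i)))
        (ℕ.n∸n≡0 D) (ℕ.n∸n≡0 D)
        (≤-respʳ-≈ (sym (*-identityˡ _)) (scale-nonneg D (D ℕ.∸ D)))
        (λ eq → scale≉0 D (D ℕ.∸ D) (trans (sym (*-identityˡ _)) eq))
        (trans (sym (distribʳ _ _ _)) (trans (*-congʳ (-‿inverseˡ 1#)) (zeroˡ _)))
        -1≤0
        (λ eq → 0≉1 (trans (sym -0#≈0#) (trans (-‿cong eq) (-‿involutive 1#))))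
        vanish)

open import Data.Nat using (ℕ; _≤_; _<_; _*_; _+_)

theorem15 : ∀ {c ℓ} (R : RealField c ℓ) (d l : ℕ)
    (β y : Fin l → RealField.Carrier R) (e : Fin l → ℕ) →
    (∀ i → e i ≤ d) →
    (∀ x → RealField._≈_ R (H₂ R d x)
    (sumFin R l (λ i → RealField._*_ R (β i) (pow R (RealField._+_ R x (y i)) (e i))))) →
    d < 2 * l + 1
theorem15 R d l β y e e≤d rep =
  -- The bound reads `d + 1 ≤ 2 * l`, while the goal unfolds to `d + 1 ≤ 2 * l + 1`.
  ℕ.≤-trans (Spline.Representation.degree-bound R d l β y e e≤d rep) (ℕ.m≤m+n (2 * l) 1)
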